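{- Let $\mathbb{N}=\{0,1,2,\dots\}$ and let $\mathcal{A}$ be the family of all functions $f_{a,b}:\mathbb{N}\to\mathbb{N}$, $f_{a,b}(n)=an+b$, with $a,b\in\mathbb{N}$, $a\neq 0$. Let $G:\mathbb{N}\times\mathbb{N}^2\to\mathbb{N}$ be given by $G(n,(a,b))=an+b$, let $R=\mathbb{N}^2\setminus\{(0,n)\mid n\in\mathbb{N}\}$ and let $\Theta_R=\{\mathcal{V}\in\beta(\mathbb{N}^2)\mid R\in\mathcal{V}\}$. Then: (1) $M(\beta\mathbb{N},\mathcal{A})=\{\mathcal{U}\in\beta\mathbb{N}\mid\text{every }A\in\mathcal{U}\text{ is AP-rich}\}$; (2) for every $\mathcal{U}\in\overline{K(\beta\mathbb{N},\oplus)}\cup\overline{K(\beta\mathbb{N},\odot)}$, $M(\beta\mathbb{N},\mathcal{A})=\overline{\{\overline{G}(\mathcal{U}\otimes\mathcal{V})\mid\mathcal{V}\in\Theta_R\}}$; (3) a set $A\subseteq\mathbb{N}$ is AP-rich if and only if for every $\mathcal{U}\in\overline{K(\beta\mathbb{N},\oplus)}$ there exists $\mathcal{V}\in\Theta_R$ such that $A\in\overline{G}(\mathcal{U}\otimes\mathcal{V})$. Here bars over sets of ultrafilters denote closure in the Stone topology of $\beta\mathbb{N}$.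
   Context: A set $A\subseteq\mathbb{N}$ is AP-rich if it contains arbitrarily long arithmetic progressions. For $\mathcal{U}\in\beta\mathbb{N}$ and $\mathcal{V}\in\beta(\mathbb{N}^2)$, the ultrafilter $\overline{G}(\mathcal{U}\otimes\mathcal{V})\in\beta\mathbb{N}$ is characterized by: $A\in\overline{G}(\mathcal{U}\otimes\mathcal{V})$ if and only if $\{n\in\mathbb{N}\mid\{(a,b)\in\mathbb{N}^2\mid an+b\in A\}\in\mathcal{V}\}\in\mathcal{U}$. For $A,B\subseteq\mathbb{N}$, $A\leq_{\mathcal{A}}B$ means that for every finite $F\subseteq A$ there is $f\in\mathcal{A}$ with $f(F)\subseteq B$. For $\mathcal{U},\mathcal{V}\in\beta\mathbb{N}$, $\mathcal{U}\leq_{\mathcal{A}}\mathcal{V}$ means that for every $B\in\mathcal{V}$ there is $A\in\mathcal{U}$ with $A\leq_{\mathcal{A}}B$. $M(\beta\mathbb{N},\mathcal{A})$ is the set of maximal ultrafilters, i.e. of those $\mathcal{U}\in\beta\mathbb{N}$ with $\mathcal{V}\leq_{\mathcal{A}}\mathcal{U}$ for every $\mathcal{V}\in\beta\mathbb{N}$. For an operation $*$ on $\mathbb{N}$ (addition or multiplication), its extension to $\beta\mathbb{N}$ (denoted $\oplus$, resp. $\odot$) is given by: $A$ belongs to the product of $\mathcal{U}$ and $\mathcal{V}$ iff $\{s\in\mathbb{N}\mid\{r\in\mathbb{N}\mid s*r\in A\}\in\mathcal{V}\}\in\mathcal{U}$. $K(\beta\mathbb{N},\oplus)$ and $K(\beta\mathbb{N},\odot)$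 are the minimal bilateral (two-sided) ideals of the respective semigroups.
   Formalization: K(βℕ,⊙) is taken as the minimal ideal of the multiplicative semigroup of ultrafilters on the positive integers; with 0 included it is just the principal ultrafilter at 0, for which (2) fails. -}

module Defs where

open import Level using (Level; 0ℓ; suc; _⊔_)
open import Data.Nat using (ℕ; _+_; _*_; _<_)
open import Data.Product using (∃-syntax; _×_; _,_)
open import Data.Sum using (_⊎_; inj₁; inj₂)
open import Data.List using (List)
open import Data.List.Relation.Unary.All using (All)
open import Relation.Nullary using (¬_)
open import Relation.Unary
  using (Pred; _∈_; _⊆_; _≐_; _≬_; _∩_; ∅; ∁; U; Satisfiable)
open import Relation.Binary using (_Respects_)
open import Relation.Binary.PropositionalEquality using (_≡_; _≢_)

private variable
  ℓ : Level
  X Y Z : Set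

------------------------------------------------------------------------
-- Ultrafilters

record β (X : Set) : Set₁ where
  field
    sets   : Pred (Pred X 0ℓ) 0ℓ
    whole  : U ∈ sets
    proper : ¬ (∅ ∈ sets)
    upward : ∀ {A B} → A ⊆ B → A ∈ sets → B ∈ sets
    inter  : ∀ {A B} → A ∈ sets → B ∈ sets → (A ∩ B) ∈ sets
    ultra  : ∀ A → A ∈ sets ⊎ ∁ A ∈ sets

open β public

-- Equality of ultrafilters as sets of sets.
infix 4 _≈_
_≈_ : β X → β X → Set₁
𝒰 ≈ 𝒱 = sets 𝒰 ≐ sets 𝒱

-- The basic (cl)open sets of the Stone topology.
⟦_⟧ : Pred X 0ℓ → Pred (β X) 0ℓ
⟦ A ⟧ 𝒰 = A ∈ sets 𝒰

-- 𝒰 is in the closure of S iff every basic open neighbourhood of 𝒰 meets S.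
closure : Pred (β X) ℓ → Pred (β X) (suc 0ℓ ⊔ ℓ)
closure S 𝒰 = ∀ A → 𝒰 ∈ ⟦ A ⟧ → S ≬ ⟦ A ⟧

-- For f : X × Y → Z (curried), the ultrafilter f̄(𝒰 ⊗ 𝒱).
extend : (X → Y → Z) → β X → β Y → β Z
extend f 𝒰 𝒱 = record
  { sets   = λ A → (λ x → (λ y → f x y ∈ A) ∈ sets 𝒱) ∈ sets 𝒰
  ; whole  = upward 𝒰 (λ _ → whole 𝒱) (whole 𝒰)
  ; proper = λ p → proper 𝒰 (upward 𝒰 (proper 𝒱) p)
  ; upward = λ A⊆B → upward 𝒰 (upward 𝒱 A⊆B)
  ; inter  = λ p q → upward 𝒰 (λ (a , b) → inter 𝒱 a b) (inter 𝒰 p q)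
  ; ultra  = λ A → split A (ultra 𝒰 (λ x → (λ y → f x y ∈ A) ∈ sets 𝒱))
  }
  where
  co : ∀ A {x} → ¬ ((λ y → f x y ∈ A) ∈ sets 𝒱) →
       (λ y → f x y ∈ ∁ A) ∈ sets 𝒱
  co A {x} n with ultra 𝒱 (λ y → f x y ∈ A)
  ... | inj₁ p with () ← n p
  ... | inj₂ q = q

  split : ∀ A →
    let E = λ x → (λ y → f x y ∈ A) ∈ sets 𝒱 in
    E ∈ sets 𝒰 ⊎ ∁ E ∈ sets 𝒰 →
    E ∈ sets 𝒰 ⊎ (λ x → (λ y → f x y ∈ ∁ A) ∈ sets 𝒱) ∈ sets 𝒰
  split A (inj₁ p) = inj₁ p
  split A (inj₂ q) = inj₂ (upward 𝒰 (co A) q)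

infixl 6 _⊕_
infixl 7 _⊙_

_⊕_ _⊙_ : β ℕ → β ℕ → β ℕ
_⊕_ = extend _+_
_⊙_ = extend _*_

------------------------------------------------------------------------
-- Minimal two-sided ideals

-- Two-sided ideals of the subsemigroup S of (β X , _∙_), as sets of
-- ultrafilters up to _≈_.
record IsIdeal (S : Pred (β X) 0ℓ) (_∙_ : β X → β X → β X)
               (I : Pred (β X) (suc 0ℓ)) : Set₁ where
  field
    within   : I ⊆ S
    respects : I Respects _≈_
    nonempty : Satisfiable I
    left     : ∀ {𝒰 𝒱} → 𝒰 ∈ S → 𝒱 ∈ I → (𝒰 ∙ 𝒱) ∈ I
    right    : ∀ {𝒰 𝒱} → 𝒰 ∈ I → 𝒱 ∈ S → (𝒰 ∙ 𝒱) ∈ I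

IsMinimalIdeal : Pred (β X) 0ℓ → (β X → β X → β X) →
                 Pred (β X) (suc 0ℓ) → Set₂
IsMinimalIdeal S _∙_ I =
  IsIdeal S _∙_ I × (∀ J → IsIdeal S _∙_ J → J ⊆ I → I ⊆ J)

-- A semigroup has at most one minimal two-sided ideal; K S _∙_ is the set of
-- its elements.
K : Pred (β X) 0ℓ → (β X → β X → β X) → Pred (β X) (suc (suc 0ℓ))
K S _∙_ 𝒰 = ∃[ I ] IsMinimalIdeal S _∙_ I × 𝒰 ∈ I

K⊕ : Pred (β ℕ) (suc (suc 0ℓ))
K⊕ = K U _⊕_

-- The multiplicative semigroup consists of the ultrafilters on the positive
-- integers.  The principal ultrafilter at 0 is a zero for _⊙_, so that with it
-- included the minimal ideal would degenerate to that single point.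
K⊙ : Pred (β ℕ) (suc (suc 0ℓ))
K⊙ = K ⟦ _≢ 0 ⟧ _⊙_

------------------------------------------------------------------------
-- The orders induced by a family of functions

infix 4 _≤[_]_ _≼[_]_

-- A finite F ⊆ A is given by a list of elements of A.
_≤[_]_ : Pred ℕ 0ℓ → Pred (ℕ → ℕ) 0ℓ → Pred ℕ 0ℓ → Set
A ≤[ 𝓕 ] B =
  ∀ (F : List ℕ) → All (_∈ A) F → ∃[ f ] f ∈ 𝓕 × All (λ n → f n ∈ B) F

_≼[_]_ : β ℕ → Pred (ℕ → ℕ) 0ℓ → β ℕ → Set₁
𝒰 ≼[ 𝓕 ] 𝒱 = ∀ B → B ∈ sets 𝒱 → ∃[ A ] A ∈ sets 𝒰 × A ≤[ 𝓕 ] B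

M : Pred (ℕ → ℕ) 0ℓ → Pred (β ℕ) (suc 0ℓ)
M 𝓕 𝒰 = ∀ 𝒱 → 𝒱 ≼[ 𝓕 ] 𝒰

𝒜 : Pred (ℕ → ℕ) 0ℓ
𝒜 f = ∃[ a ] ∃[ b ] a ≢ 0 × (∀ n → f n ≡ a * n + b)

------------------------------------------------------------------------
-- Arithmetic progressions

APRich : Pred ℕ 0ℓ → Set
APRich A = ∀ k → ∃[ b ] ∃[ d ] d ≢ 0 × (∀ i → i < k → (b + i * d) ∈ A)

G : ℕ → ℕ × ℕ → ℕ
G n (a , b) = a * n + b

Ḡ : β ℕ → β (ℕ × ℕ) → β ℕ
Ḡ = extend G

R : Pred (ℕ × ℕ) 0ℓ
R = ∁ (λ p → ∃[ n ] p ≡ (0 , n))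

Θ_R : Pred (β (ℕ × ℕ)) 0ℓ
Θ_R = ⟦ R ⟧

-- { Ḡ(𝒰 ⊗ 𝒱) ∣ 𝒱 ∈ Θ_R }
Ḡ-image : β ℕ → Pred (β ℕ) (suc 0ℓ)
Ḡ-image 𝒰 𝒲 = ∃[ 𝒱 ] 𝒱 ∈ Θ_R × 𝒲 ≈ Ḡ 𝒰 𝒱

{-# OPTIONS --safe #-}
-- Affine maps with nonzero slope preserve arithmetic progressions, so the
-- ultrafilters all of whose members are AP-rich form a two-sided ideal of
-- (βℕ , ⊕) and, by the same argument, of (βℕ ∖ {0} , ⊙), and they are stable
-- under Ḡ(– ⊗ 𝒱) for 𝒱 ∈ Θ_R.  This ideal is nonempty by van der Waerden's
-- theorem, hence contains the minimal ideals.  Conversely, if A is AP-rich, the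
-- sets {(a , b) ∈ R ∣ an + b ∈ A}, n ∈ ℕ, have the finite intersection property,
-- and any 𝒱 containing them satisfies A ∈ Ḡ(𝒰 ⊗ 𝒱) for every 𝒰.  The minimal
-- ideal of (βℕ , ⊕) exists because the ultrafilters extending a maximal filter
-- of thick sets form a minimal left ideal.
-- Zorn-type arguments are available since excluded middle holds for all types,
-- not only for propositions: it picks an element of every nonempty type.
module Submission where

open import Level using (Level; 0ℓ)
open import Axiom.ExcludedMiddle using (ExcludedMiddle)
open import Axiom.Extensionality.Propositional using (Extensionality)
open import Data.Bool using (Bool; true; false; T)
open import Data.Empty using (⊥; ⊥-elim)
open import Data.Fin using (Fin; zero; suc; toℕ; fromℕ<; funToFin; finToFun)
open import Data.Fin.Properties using (pigeonhole; finToFun-funToFin; toℕ-fromℕ<; any?)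
  renaming (_≟_ to _≟ᶠ_; <⇒≢ to <ᶠ⇒≢)
open import Data.List using (List; []; _∷_; foldr; length; _++_; lookup; applyUpTo)
open import Data.List.Membership.Propositional using () renaming (_∈_ to _∈ˡ_)
open import Data.List.Membership.Propositional.Properties using (∈-lookup)
open import Data.List.Relation.Binary.Subset.Propositional using () renaming (_⊆_ to _⊆ˡ_)
open import Data.List.Relation.Unary.All using (All; []; _∷_) renaming (map to mapᴬ; lookup to lookupᴬ)
open import Data.List.Relation.Unary.All.Properties using (applyUpTo⁺₁; applyUpTo⁻; ++⁺)
open import Data.List.Relation.Unary.Any using (here; there)
open import Data.Nat using (ℕ; zero; suc; _+_; _*_; _^_; _<_; _≤_; _⊔_; z≤n; s≤s)
open import Data.Nat.Properties
open import Data.Nat.Tactic.RingSolver using (solve-∀)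
open import Data.Product using (_×_; ∃-syntax; _,_; proj₁; proj₂)
open import Data.Sum using (_⊎_; inj₁; inj₂; [_,_]′)
open import Data.Unit using (tt)
open import Function using (_∘_; id)
open import Function.Bundles using (_⇔_; mk⇔)
open import Function.Definitions using (Injective)
open import Relation.Binary.PropositionalEquality
open import Relation.Nullary using (¬_; yes; no)
open import Relation.Nullary.Decidable using (⌊_⌋; toWitness; fromWitness; decidable-stable)
open import Relation.Unary using (Pred; _∈_; _⊆_; _∩_; _∪_; _≐_; ∁; U; Satisfiable)
open import Defs

private variable
  ℓ : Level
  X Y : Set

-- van der Waerden's theorem, by colour focusing

-- Chosen so that `APRich A` unfolds to `∀ k → HasAP k A`.
HasAP : ℕ → Pred ℕ 0ℓ → Set
HasAP k A = ∃[ b ] ∃[ d ] d ≢ 0 × (∀ i → i < k → (b + i * d) ∈ A)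

HasAP-≤ : ∀ {k l} A → k ≤ l → HasAP l A → HasAP k A
HasAP-≤ A k≤l (b , d , d≢0 , h) = b , d , d≢0 , λ i i<k → h i (<-≤-trans i<k k≤l)

-- The bound also covers the term after the last, which may have any colour: it is the future focus.
Monochromatic : ∀ {r} → ℕ → ℕ → (ℕ → Fin r) → Set
Monochromatic k N χ =
  ∃[ a ] ∃[ d ] d ≢ 0 × a + k * d ≤ N × ∃[ c ] (∀ i → i < k → χ (a + i * d) ≡ c)

Monochromatic-shift : ∀ {r k N N′} (χ : ℕ → Fin r) t → t + N ≤ N′ →
  Monochromatic k N (λ n → χ (t + n)) → Monochromatic k N′ χ
Monochromatic-shift {k = k} {N} χ t t+N≤N′ (a , d , d≢0 , le , c , h) =
  t + a , d , d≢0 ,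
  ≤-trans (≤-reflexive (+-assoc t a (k * d))) (≤-trans (+-monoʳ-≤ t le) t+N≤N′) ,
  c , λ i i<k → trans (cong χ (+-assoc t a (i * d))) (h i i<k)

-- The common next term `f` is the focus. Injectivity of `c` forces `s ≤ r`, which ends the
-- induction.
Focused : ∀ {r} → ℕ → ℕ → ℕ → (ℕ → Fin r) → Set
Focused {r} k s N χ =
  ∃[ f ] f ≤ N × ∃[ c ] Injective {A = Fin s} {B = Fin r} _≡_ _≡_ c ×
  (∀ j → ∃[ a ] ∃[ d ] d ≢ 0 × a + k * d ≡ f × (∀ i → i < k → χ (a + i * d) ≡ c j))

VanDerWaerden : ℕ → Set
VanDerWaerden k = ∀ r → ∃[ N ] (∀ (χ : ℕ → Fin r) → Monochromatic k N χ)

-- A window of `N + 1` positions becomes one colour, so that progressions of equally coloured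
-- windows can be found.
block : ∀ {r} N → (ℕ → Fin r) → ℕ → Fin (r ^ suc N)
block N χ n = funToFin (λ (j : Fin (suc N)) → χ (n + toℕ j))

block-injective : ∀ {r} N (χ : ℕ → Fin r) {m n} → block N χ m ≡ block N χ n →
  ∀ {t} → t ≤ N → χ (m + t) ≡ χ (n + t)
block-injective N χ {m} {n} eq {t} t≤N =
  trans (sym (decode m)) (trans (cong (λ e → finToFun e j) eq) (decode n))
  where
  j = fromℕ< (s≤s t≤N)
  decode : ∀ x → finToFun (block N χ x) j ≡ χ (x + t)
  decode x = trans (finToFun-funToFin (λ j → χ (x + toℕ j)) j)
                   (cong (λ e → χ (x + e)) (toℕ-fromℕ< (s≤s t≤N)))

-- Induction on `s`. Windows starting at `t + i * D` are coloured alike, so a progression of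
-- difference `d` in the first window also runs diagonally across them with difference `d + D`; the
-- old focus, repeated with difference `D`, supplies one more progression.
focus : ∀ k → VanDerWaerden (suc k) → ∀ r s →
  ∃[ N ] (∀ (χ : ℕ → Fin r) →
    Monochromatic (suc (suc k)) (N + N) χ ⊎ Focused (suc k) s N χ)
focus k vdw r zero = 0 , λ χ → inj₂ (0 , z≤n , (λ ()) , (λ { {()} }) , λ ())
focus k vdw r (suc s) with focus k vdw r s
... | N , ih with vdw (r ^ suc N)
...   | L , mono = L + N , step
  where
  step : ∀ χ → Monochromatic (suc (suc k)) (L + N + (L + N)) χ ⊎ Focused (suc k) (suc s) (L + N) χ
  step χ with mono (block N χ)
  ... | t , D , D≢0 , t+kD≤L , cᵇ , sameᵇ = result (ih (λ n → χ (t + n)))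
    where
    t≤L : t ≤ L
    t≤L = ≤-trans (m≤m+n t _) t+kD≤L

    room : t + (N + N) ≤ L + N + (L + N)
    room = ≤-trans (+-monoˡ-≤ (N + N) t≤L)
             (≤-trans (≤-reflexive (sym (+-assoc L N N))) (+-monoʳ-≤ (L + N) (m≤n+m N L)))

    same : ∀ {i} → i < suc k → ∀ {n} → n ≤ N → χ (t + i * D + n) ≡ χ (t + n)
    same {i} i<k {n} n≤N = trans
      (block-injective N χ {t + i * D} {t + 0 * D} (trans (sameᵇ i i<k) (sym (sameᵇ 0 (s≤s z≤n)))) n≤N)
      (cong (λ e → χ (e + n)) (+-identityʳ t))

    result : Monochromatic (suc (suc k)) (N + N) (λ n → χ (t + n)) ⊎ Focused (suc k) s N (λ n → χ (t + n)) →
      Monochromatic (suc (suc k)) (L + N + (L + N)) χ ⊎ Focused (suc k) (suc s) (L + N) χ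
    result (inj₁ m) = inj₁ (Monochromatic-shift χ t room m)
    -- If the focus has the colour of some progression, it extends that progression by a term;
    -- otherwise its colour is new.
    result (inj₂ (f , f≤N , c , c-inj , aps)) with any? (λ j → c j ≟ᶠ χ (t + f))
    ... | yes (j , cj≡) with aps j
    ...   | a , d , d≢0 , a+kd≡f , h =
      inj₁ (Monochromatic-shift χ t room (a , d , d≢0 , le , c j , h′))
      where
      -- The bound reaches one step past the focus, and `d ≤ f ≤ N`.
      le : a + suc (suc k) * d ≤ N + N
      le = begin
        a + (d + suc k * d)   ≡⟨ eq a d (suc k * d) ⟩
        (a + suc k * d) + d   ≤⟨ +-monoʳ-≤ (a + suc k * d) (≤-trans (m≤m+n d (k * d)) (m≤n+m (suc k * d) a)) ⟩
        (a + suc k * d) + (a + suc k * d) ≡⟨ cong₂ _+_ a+kd≡f a+kd≡f ⟩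
        f + f                 ≤⟨ +-mono-≤ f≤N f≤N ⟩
        N + N                 ∎
        where
        open ≤-Reasoning
        eq : ∀ a d e → a + (d + e) ≡ (a + e) + d
        eq = solve-∀
      h′ : ∀ i → i < suc (suc k) → χ (t + (a + i * d)) ≡ c j
      h′ i i<2+k with m<1+n⇒m<n∨m≡n i<2+k
      ... | inj₁ i<1+k = h i i<1+k
      ... | inj₂ refl  = trans (cong (λ e → χ (t + e)) a+kd≡f) (sym cj≡)
    result (inj₂ (f , f≤N , c , c-inj , aps)) | no new =
      inj₂ (t + f + suc k * D , bound , c′ , c′-inj , aps′)
      where
      bound : t + f + suc k * D ≤ L + N
      bound = ≤-trans (≤-reflexive (eq t f (suc k * D))) (+-mono-≤ t+kD≤L f≤N)
        where
        eq : ∀ a b c → a + b + c ≡ a + c + b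
        eq = solve-∀
      c′ : Fin (suc s) → Fin r
      c′ zero    = χ (t + f)
      c′ (suc j) = c j
      c′-inj : Injective _≡_ _≡_ c′
      c′-inj {zero}  {zero}  eq = refl
      c′-inj {zero}  {suc j} eq = ⊥-elim (new (j , sym eq))
      c′-inj {suc j} {zero}  eq = ⊥-elim (new (j , eq))
      c′-inj {suc i} {suc j} eq = cong suc (c-inj eq)
      aps′ : ∀ j → ∃[ a ] ∃[ d ] d ≢ 0 × a + suc k * d ≡ t + f + suc k * D ×
               (∀ i → i < suc k → χ (a + i * d) ≡ c′ j)
      aps′ zero = t + f , D , D≢0 , refl , λ i i<k →
        trans (cong χ (eq t f (i * D))) (same i<k f≤N)
        where
        eq : ∀ a b c → a + b + c ≡ a + c + b
        eq = solve-∀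
      aps′ (suc j) with aps j
      ... | a , d , d≢0 , a+kd≡f , h =
        t + a , d + D , (λ e → d≢0 (m+n≡0⇒m≡0 d e)) ,
        trans (eq t a d D (suc k)) (cong (λ e → t + e + suc k * D) a+kd≡f) ,
        λ i i<k → trans (cong χ (eq′ t a d D i))
          (trans (same i<k (term≤N i<k)) (h i i<k))
        where
        eq : ∀ t a d D k → t + a + k * (d + D) ≡ t + (a + k * d) + k * D
        eq = solve-∀
        eq′ : ∀ t a d D i → t + a + i * (d + D) ≡ t + i * D + (a + i * d)
        eq′ = solve-∀
        term≤N : ∀ {i} → i < suc k → a + i * d ≤ N
        term≤N i<k = ≤-trans (+-monoʳ-≤ a (*-monoˡ-≤ d (<⇒≤ i<k)))
                       (≤-trans (≤-reflexive a+kd≡f) f≤N)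

-- Asking `focus` for more progressions than there are colours leaves only its first alternative.
vanDerWaerden : ∀ k → VanDerWaerden (suc k)
vanDerWaerden zero r = 1 , λ χ → 0 , 1 , (λ ()) , ≤-refl , χ 0 , λ { zero _ → refl ; (suc _) (s≤s ()) }
vanDerWaerden (suc k) r with focus k (vanDerWaerden k) r (suc r)
... | N , F = N + N , λ χ → [ id , (λ foc → ⊥-elim (overfull χ foc)) ]′ (F χ)
  where
  overfull : ∀ χ → ¬ Focused (suc k) (suc r) N χ
  overfull _ (_ , _ , c , c-inj , _) with pigeonhole (n<1+n r) c
  ... | i , j , i<j , ci≡cj = <ᶠ⇒≢ i<j (c-inj ci≡cj)

-- Affine images of arithmetic progressions

HasAP-preimage : ∀ {f k} A → f ∈ 𝒜 → HasAP k (A ∘ f) → HasAP k A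
HasAP-preimage A (a , c , a≢0 , f≗) (b , d , d≢0 , h) =
  a * b + c , a * d , (λ e → [ a≢0 , d≢0 ]′ (m*n≡0⇒m≡0∨n≡0 a e)) ,
  λ i i<k → subst A (trans (f≗ (b + i * d)) (eq a b c d i)) (h i i<k)
  where
  eq : ∀ a b c d i → a * (b + i * d) + c ≡ a * b + c + i * (a * d)
  eq = solve-∀

translation-affine : ∀ s → (s +_) ∈ 𝒜
translation-affine s = 1 , s , (λ ()) , λ n →
  trans (+-comm s n) (cong (_+ s) (sym (+-identityʳ n)))

translation-affineʳ : ∀ s → (_+ s) ∈ 𝒜
translation-affineʳ s = 1 , s , (λ ()) , λ n → cong (_+ s) (sym (+-identityʳ n))

dilation-affine : ∀ {s} → s ≢ 0 → (s *_) ∈ 𝒜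
dilation-affine {s} s≢0 = s , 0 , s≢0 , λ n → sym (+-identityʳ (s * n))

dilation-affineʳ : ∀ {s} → s ≢ 0 → (_* s) ∈ 𝒜
dilation-affineʳ {s} s≢0 = s , 0 , s≢0 , λ n → trans (*-comm n s) (sym (+-identityʳ (s * n)))

-- The `n`-th term of a progression is the value at `n` of an affine map whose slope is the common
-- difference.
G-term : ∀ b d n → b + n * d ≡ G n (d , b)
G-term b d n = trans (+-comm b (n * d)) (cong (_+ b) (*-comm n d))

R⇒≢0 : ∀ {p} → p ∈ R → proj₁ p ≢ 0
R⇒≢0 {a , b} r a≡0 = r (b , cong (_, b) a≡0)

≢0⇒R : ∀ {a b} → a ≢ 0 → (a , b) ∈ R
≢0⇒R a≢0 (_ , e) = a≢0 (cong proj₁ e)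

-- Rich ultrafilters

Rich : Pred (β ℕ) _
Rich 𝒰 = ∀ A → A ∈ sets 𝒰 → APRich A

bounded-inter : (𝒰 : β X) (E : ℕ → Pred X 0ℓ) → ∀ k → (∀ i → i < k → E i ∈ sets 𝒰) →
  (λ x → ∀ i → i < k → x ∈ E i) ∈ sets 𝒰
bounded-inter 𝒰 E zero _ = upward 𝒰 (λ _ _ ()) (whole 𝒰)
bounded-inter 𝒰 E (suc k) h =
  upward 𝒰 (λ (lt , eq) i i<1+k → [ lt i , (λ { refl → eq }) ]′ (m<1+n⇒m<n∨m≡n i<1+k))
    (inter 𝒰 (bounded-inter 𝒰 E k (λ i i<k → h i (m<n⇒m<1+n i<k))) (h k ≤-refl))

-- Finite intersections and maximal filters

⋂ : List (Pred X 0ℓ) → Pred X 0ℓ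
⋂ = foldr _∩_ U

∈⇒⋂⊆ : ∀ {A : Pred X 0ℓ} {L} → A ∈ˡ L → ⋂ L ⊆ A
∈⇒⋂⊆ (here refl) (a , _) = a
∈⇒⋂⊆ (there A∈L) (_ , l) = ∈⇒⋂⊆ A∈L l

⋂-antitone : ∀ {L L′ : List (Pred X 0ℓ)} → L ⊆ˡ L′ → ⋂ L′ ⊆ ⋂ L
⋂-antitone {L = []}    L⊆L′ l = tt
⋂-antitone {L = A ∷ L} L⊆L′ l = ∈⇒⋂⊆ (L⊆L′ (here refl)) l , ⋂-antitone (L⊆L′ ∘ there) l

-- For monotone `P`, upward closure follows from `∩-member`, `large` and `maximal`. The instances
-- are `Satisfiable`, giving ultrafilters, and `Thick`.
record MaximalFilter (P : Pred (Pred X 0ℓ) 0ℓ) : Set₁ where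
  field
    member   : Pred (Pred X 0ℓ) 0ℓ
    ∩-member : ∀ {A B} → A ∈ member → B ∈ member → (A ∩ B) ∈ member
    large    : member ⊆ P
    maximal  : ∀ A → (∀ B → B ∈ member → P (A ∩ B)) → A ∈ member

module _ (em : ∀ {ℓ} → ExcludedMiddle ℓ) where

  dne : {P : Set ℓ} → ¬ ¬ P → P
  dne = decidable-stable em

  nonempty-member : (𝒰 : β X) → ∀ {A} → A ∈ sets 𝒰 → Satisfiable A
  nonempty-member 𝒰 A∈𝒰 = dne λ empty →
    proper 𝒰 (upward 𝒰 (λ {x} x∈A → empty (x , x∈A)) A∈𝒰)

  ∉⇒∁∈ : (𝒰 : β X) → ∀ {A} → ¬ (A ∈ sets 𝒰) → ∁ A ∈ sets 𝒰
  ∉⇒∁∈ 𝒰 {A} A∉𝒰 = [ ⊥-elim ∘ A∉𝒰 , id ]′ (ultra 𝒰 A)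

  ⊆⇒≈ : ∀ {𝒰 𝒱 : β X} → sets 𝒰 ⊆ sets 𝒱 → 𝒰 ≈ 𝒱
  ⊆⇒≈ {𝒰 = 𝒰} {𝒱} 𝒰⊆𝒱 = 𝒰⊆𝒱 , λ {A} A∈𝒱 → dne λ A∉𝒰 →
    proper 𝒱 (upward 𝒱 (λ (a , ¬a) → ¬a a) (inter 𝒱 A∈𝒱 (𝒰⊆𝒱 (∉⇒∁∈ 𝒰 A∉𝒰))))

  -- The `k` terms of a progression impose finitely many `𝒱`-large conditions on `y`, so a single
  -- `y` with an affine section carries all of them into `A`.
  extend-richˡ : (g : ℕ → Y → ℕ) (𝒰 : β ℕ) (𝒱 : β Y) → Rich 𝒰 →
    (λ y → (λ n → g n y) ∈ 𝒜) ∈ sets 𝒱 → Rich (extend g 𝒰 𝒱)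
  extend-richˡ g 𝒰 𝒱 rich affine A A∈ k with rich _ A∈ k
  ... | b , d , d≢0 , h
    with nonempty-member 𝒱 (inter 𝒱 affine (bounded-inter 𝒱 (λ i y → A (g (b + i * d) y)) k h))
  ... | y , aff , h′ = HasAP-preimage A aff (b , d , d≢0 , h′)

  extend-richʳ : (g : X → ℕ → ℕ) (𝒰 : β X) (𝒱 : β ℕ) → (λ x → g x ∈ 𝒜) ∈ sets 𝒰 →
    Rich 𝒱 → Rich (extend g 𝒰 𝒱)
  extend-richʳ g 𝒰 𝒱 affine rich A A∈ k with nonempty-member 𝒰 (inter 𝒰 affine A∈)
  ... | x , aff , h = HasAP-preimage A aff (rich _ h k)

  -- `I ∩ Rich` is again an ideal, inhabited by a product `𝓅 ∙ 𝓆` with `𝓅` rich and `𝓆` in `I`;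
  -- minimality of `I` does the rest.
  minimalIdeal-rich : ∀ {S : Pred (β ℕ) 0ℓ} {_∙_ : β ℕ → β ℕ → β ℕ} {I} →
    (∃[ 𝓅 ] 𝓅 ∈ S × Rich 𝓅) →
    (∀ {𝒰 𝒱} → 𝒰 ∈ S → Rich 𝒱 → Rich (𝒰 ∙ 𝒱)) →
    (∀ {𝒰 𝒱} → Rich 𝒰 → 𝒱 ∈ S → Rich (𝒰 ∙ 𝒱)) →
    IsMinimalIdeal S _∙_ I → I ⊆ Rich
  minimalIdeal-rich {I = I} (𝓅 , 𝓅∈S , 𝓅-rich) richʳ richˡ (ideal , minimal) =
    proj₂ ∘ minimal (I ∩ Rich) (record
      { within   = ideal.within ∘ proj₁
      ; respects = λ 𝒰≈𝒱 (i , r) → ideal.respects 𝒰≈𝒱 i , λ A A∈ → r A (proj₂ 𝒰≈𝒱 A∈)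
      ; nonempty = let 𝓆 , 𝓆∈I = ideal.nonempty in
          _ , ideal.left 𝓅∈S 𝓆∈I , richˡ 𝓅-rich (ideal.within 𝓆∈I)
      ; left     = λ s (i , r) → ideal.left s i , richʳ s r
      ; right    = λ (i , r) s → ideal.right i s , richˡ r s
      }) proj₁
    where module ideal = IsIdeal ideal

  -- Teichmüller–Tukey and maximal filters

  module _ (ext : ∀ {a b} → Extensionality a b) where

    -- A subset is a Bool-valued function, so that extensionally equal subsets
    -- are equal and have the same chosen extension.
    module Tukey {Y : Set₁} (Good : Pred (List Y) 0ℓ)
      (antitone : ∀ {L L′} → L ⊆ˡ L′ → Good L′ → Good L)
      (S₀ : Pred Y ℓ) (S₀-good : ∀ L → All S₀ L → Good L) where

      Subset : Set₁
      Subset = Y → Bool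

      ⟨_⟩ : Subset → Pred Y 0ℓ
      ⟨ s ⟩ y = T (s y)

      infix 4 _≤ˢ_
      _≤ˢ_ : Subset → Subset → Set₁
      s ≤ˢ t = ⟨ s ⟩ ⊆ ⟨ t ⟩

      -- Excluded middle brings a predicate of any level down to a Bool-valued one.
      comprehension : ∀ {A : Set₁} {ℓ} → Pred A ℓ → A → Bool
      comprehension P y = ⌊ em {P = P y} ⌋

      comprehension⁺ : ∀ {A : Set₁} {ℓ} (P : Pred A ℓ) {y} → P y → T (comprehension P y)
      comprehension⁺ P {y} = fromWitness {a? = em {P = P y}}

      comprehension⁻ : ∀ {A : Set₁} {ℓ} (P : Pred A ℓ) {y} → T (comprehension P y) → P y
      comprehension⁻ P {y} = toWitness {a? = em {P = P y}}

      T-ext : ∀ {b c} → (T b → T c) → (T c → T b) → b ≡ c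
      T-ext {false} {false} _ _ = refl
      T-ext {false} {true}  _ g = ⊥-elim (g tt)
      T-ext {true}  {false} f _ = ⊥-elim (f tt)
      T-ext {true}  {true}  _ _ = refl

      ≤ˢ-antisym : ∀ {s t} → s ≤ˢ t → t ≤ˢ s → s ≡ t
      ≤ˢ-antisym s≤t t≤s = ext λ y → T-ext s≤t t≤s

      Extends : Subset → Pred Y _
      Extends s y = ¬ y ∈ ⟨ s ⟩ × (∀ L → All ⟨ s ⟩ L → Good (y ∷ L))

      adjoin : Subset → Y → Pred Y _
      adjoin s y₀ y = y ∈ ⟨ s ⟩ ⊎ y ≡ y₀

      -- Adds a chosen new element whenever a good one exists, so that sets with `next s ≤ˢ s` are
      -- maximal.
      next : Subset → Subset
      next s with em {P = ∃[ y ] Extends s y}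
      ... | yes (y₀ , _) = comprehension (adjoin s y₀)
      ... | no _         = s

      ≤-next : ∀ s → s ≤ˢ next s
      ≤-next s y∈s with em {P = ∃[ y ] Extends s y}
      ... | yes (y₀ , _) = comprehension⁺ (adjoin s y₀) (inj₁ y∈s)
      ... | no _  = y∈s

      next-good : ∀ s → (∀ L → All ⟨ s ⟩ L → Good L) → ∀ L → All ⟨ next s ⟩ L → Good L
      next-good s good L all with em {P = ∃[ y ] Extends s y}
      ... | no _ = good L all
      -- All copies of `y₀` in `L` are merged into one at the head, the shape to which `extends`
      -- applies.
      ... | yes (y₀ , _ , extends) with remove L all
        where
        remove : ∀ L → All (λ y → T (comprehension (adjoin s y₀) y)) L →
          ∃[ L′ ] All ⟨ s ⟩ L′ × L ⊆ˡ y₀ ∷ L′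
        remove [] [] = [] , [] , λ ()
        remove (y ∷ L) (p ∷ ps) with comprehension⁻ (adjoin s y₀) p | remove L ps
        ... | inj₁ y∈s  | L′ , all′ , sub = y ∷ L′ , y∈s ∷ all′ , λ
          { (here refl) → there (here refl)
          ; (there z∈) → skip (sub z∈) }
          where
          skip : ∀ {z} → z ∈ˡ y₀ ∷ L′ → z ∈ˡ y₀ ∷ y ∷ L′
          skip (here e)  = here e
          skip (there z) = there (there z)
        ... | inj₂ refl | L′ , all′ , sub = L′ , all′ , λ
          { (here refl) → here refl ; (there z∈) → sub z∈ }
      ... | L′ , all′ , sub = antitone sub (extends L′ all′)

      next-maximal : ∀ s → next s ≤ˢ s → ∀ y → (∀ L → All ⟨ s ⟩ L → Good (y ∷ L)) → y ∈ ⟨ s ⟩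
      next-maximal s le y extends with em {P = ∃[ y ] Extends s y}
      ... | yes (y₀ , y₀∉s , _) = ⊥-elim (y₀∉s (le (comprehension⁺ (adjoin s y₀) (inj₂ refl))))
      ... | no maximal = dne λ y∉s → maximal (y , y∉s , extends)

      ⋃next : (Subset → Bool) → Pred Y _
      ⋃next C y = S₀ y ⊎ ∃[ s ] T (C s) × y ∈ ⟨ next s ⟩

      -- Zermelo's tower with a single constructor: empty `C` gives `S₀`, a singleton gives a
      -- successor, larger `C` give limits.
      data Tower : Subset → Set₁ where
        sup : (C : Subset → Bool) → (∀ s → T (C s) → Tower s) →
          Tower (comprehension (⋃next C))

      S₀≤ : ∀ {s} → Tower s → ∀ {y} → S₀ y → y ∈ ⟨ s ⟩
      S₀≤ (sup C h) y∈S₀ = comprehension⁺ (⋃next C) (inj₁ y∈S₀)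

      next≤sup : ∀ C s → T (C s) →
        next s ≤ˢ comprehension (⋃next C)
      next≤sup C s s∈C y∈ = comprehension⁺ (⋃next C) (inj₂ (s , s∈C , y∈))

      -- Induction on both towers, with the arguments swapped in the inner call. If `next s` is not
      -- below `t`, then no `c` in `C` equals `s` or contains `next s`, so every `next c` lies below
      -- `s`.
      compare : ∀ {s t} → Tower s → Tower t → next s ≤ˢ t ⊎ t ≤ˢ s
      compare {s} {t} s↑ (sup C h) with em {P = next s ≤ˢ t}
      ... | yes le = inj₁ le
      ... | no nle = inj₂ λ y∈t → [ S₀≤ s↑ , (λ (c , c∈C , y∈) → below c c∈C y∈) ]′ (comprehension⁻ (⋃next C) y∈t)
        where
        below : ∀ c → T (C c) → next c ≤ˢ s
        below c c∈C with compare s↑ (h c c∈C)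
        ... | inj₁ s⁺≤c = ⊥-elim (nle (next≤sup C c c∈C ∘ ≤-next c ∘ s⁺≤c))
        ... | inj₂ c≤s with compare (h c c∈C) s↑
        ...   | inj₁ c⁺≤s = c⁺≤s
        ...   | inj₂ s≤c = ⊥-elim (nle (subst (λ r → next r ≤ˢ t) (≤ˢ-antisym c≤s s≤c) (next≤sup C c c∈C)))

      next-total : ∀ {s t} → Tower s → Tower t → next s ≤ˢ next t ⊎ next t ≤ˢ next s
      next-total {s} {t} s↑ t↑ with compare s↑ t↑
      ... | inj₁ s⁺≤t = inj₁ (≤-next t ∘ s⁺≤t)
      ... | inj₂ t≤s with compare t↑ s↑
      ...   | inj₁ t⁺≤s = inj₂ (≤-next s ∘ t⁺≤s)
      ...   | inj₂ s≤t = inj₁ (subst (λ r → next s ≤ˢ next r) (≤ˢ-antisym s≤t t≤s) id)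

      -- By linearity, a finite list from the union lies in `S₀` or in a single `next s`.
      tower-good : ∀ {s} → Tower s → ∀ L → All ⟨ s ⟩ L → Good L
      tower-good (sup C h) L all with uniform L all
        where
        uniform : ∀ L → All ⟨ comprehension (⋃next C) ⟩ L →
          All S₀ L ⊎ ∃[ s ] T (C s) × All ⟨ next s ⟩ L
        uniform [] [] = inj₁ []
        uniform (y ∷ L) (p ∷ ps) with comprehension⁻ (⋃next C) p | uniform L ps
        ... | inj₁ y∈S₀ | inj₁ all = inj₁ (y∈S₀ ∷ all)
        ... | inj₁ y∈S₀ | inj₂ (s , s∈C , all) = inj₂ (s , s∈C , ≤-next s (S₀≤ (h s s∈C) y∈S₀) ∷ all)
        ... | inj₂ (s , s∈C , y∈) | inj₁ all = inj₂ (s , s∈C , y∈ ∷ mapᴬ (≤-next s ∘ S₀≤ (h s s∈C)) all)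
        ... | inj₂ (s , s∈C , y∈) | inj₂ (t , t∈C , all) with next-total (h s s∈C) (h t t∈C)
        ...   | inj₁ le = inj₂ (t , t∈C , le y∈ ∷ all)
        ...   | inj₂ le = inj₂ (s , s∈C , y∈ ∷ mapᴬ le all)
      ... | inj₁ all₀ = S₀-good L all₀
      ... | inj₂ (s , s∈C , all′) = next-good s (tower-good (h s s∈C)) L all′

      -- Built from the whole tower and itself a stage of it, hence it contains its own `next`.
      maximum : Subset
      maximum = comprehension (⋃next (comprehension Tower))

      maximum↑ : Tower maximum
      maximum↑ = sup (comprehension Tower) (λ _ → comprehension⁻ Tower)

      maximum-good : ∀ L → All ⟨ maximum ⟩ L → Good L
      maximum-good = tower-good maximum↑

      maximum-maximal : ∀ y → (∀ L → All ⟨ maximum ⟩ L → Good (y ∷ L)) → y ∈ ⟨ maximum ⟩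
      maximum-maximal = next-maximal maximum (next≤sup (comprehension Tower) maximum (comprehension⁺ Tower maximum↑))

    -- A family is good when its finite intersections satisfy `P`. These intersections are members
    -- by maximality, so testing against single members is as strong as testing against lists.
    maximalFilter : (P : Pred (Pred X 0ℓ) 0ℓ) → (∀ {A B} → A ⊆ B → P A → P B) →
      (S₀ : Pred (Pred X 0ℓ) ℓ) → (∀ L → All S₀ L → P (⋂ L)) →
      ∃[ F ] S₀ ⊆ MaximalFilter.member {P = P} F
    maximalFilter {X = X} P monotone S₀ S₀-large = record
      { member   = member
      ; ∩-member = λ {A} {B} A∈ B∈ → maximum-maximal (A ∩ B) λ L all →
          monotone (λ (a , b , l) → (a , b) , l) (maximum-good (A ∷ B ∷ L) (A∈ ∷ B∈ ∷ all))
      ; large    = λ {A} A∈ → monotone proj₁ (maximum-good (A ∷ []) (A∈ ∷ []))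
      ; maximal  = λ A large → maximum-maximal A λ L all → large (⋂ L) (⋂∈ L all)
      } , S₀≤ maximum↑
      where
      open Tukey (P ∘ ⋂) (λ L⊆L′ → monotone (⋂-antitone L⊆L′)) S₀ S₀-large
      member : Pred (Pred X 0ℓ) 0ℓ
      member = ⟨ maximum ⟩
      ⋂∈ : ∀ L → All member L → ⋂ L ∈ member
      ⋂∈ L all = maximum-maximal (⋂ L) λ L′ all′ →
        both L L′ all all′
        where
        reassoc : ∀ K K′ → ⋂ (K ++ K′) ⊆ ⋂ K ∩ ⋂ K′
        reassoc [] K′ k = tt , k
        reassoc (A ∷ K) K′ (a , k) = (a , proj₁ (reassoc K K′ k)) , proj₂ (reassoc K K′ k)
        both : ∀ K K′ → All member K → All member K′ → P (⋂ K ∩ ⋂ K′)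
        both K K′ k k′ = monotone (reassoc K K′) (maximum-good (K ++ K′) (++⁺ k k′))

    -- Ultrafilters from the finite intersection property

    ultrafilter-⊇ : (S₀ : Pred (Pred X 0ℓ) ℓ) → (∀ L → All S₀ L → Satisfiable (⋂ L)) →
      ∃[ 𝒰 ] S₀ ⊆ sets {X} 𝒰
    ultrafilter-⊇ {X = X} S₀ fip with maximalFilter Satisfiable (λ A⊆B (x , a) → x , A⊆B a) S₀ fip
    ... | F , S₀⊆F = record
      { sets   = member
      ; whole  = maximal U λ B B∈ → let x , b = large B∈ in x , tt , b
      ; proper = λ ∅∈ → proj₂ (large ∅∈)
      ; upward = λ {A} {A′} A⊆A′ A∈ → maximal A′ λ B B∈ →
          let x , a , b = large (∩-member A∈ B∈) in x , A⊆A′ a , b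
      ; inter  = ∩-member
      ; ultra  = dichotomy
      } , S₀⊆F
      where
      open MaximalFilter F
      dichotomy : ∀ A → A ∈ member ⊎ ∁ A ∈ member
      dichotomy A with em {P = ∃[ B ] B ∈ member × ¬ Satisfiable (A ∩ B)}
      ... | no meets = inj₁ (maximal A λ B B∈ → dne λ empty → meets (B , B∈ , empty))
      -- `B` misses `A`, so every point of `B ∩ C` lies in `∁ A`.
      ... | yes (B , B∈ , empty) = inj₂ (maximal (∁ A) λ C C∈ →
        let x , b , c = large (∩-member B∈ C∈) in x , (λ a → empty (x , a , b)) , c)

    -- Existence of rich ultrafilters

    ¬APRich⇒shortAP : ∀ A → ¬ APRich A → ∃[ k ] ¬ HasAP k A
    ¬APRich⇒shortAP A ¬rich = dne λ none → ¬rich λ k → dne {P = HasAP k A} λ ¬ap → none (k , ¬ap)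

    commonBound : ∀ L → All (λ B → ¬ APRich (∁ B)) L → ∃[ k ] All (λ B → ¬ HasAP k (∁ B)) L
    commonBound [] [] = 0 , []
    commonBound (B ∷ L) (p ∷ ps) with ¬APRich⇒shortAP (∁ B) p | commonBound L ps
    ... | k , ¬k | l , ¬l = k ⊔ l ,
      (¬k ∘ HasAP-≤ (∁ B) (m≤m⊔n k l)) ∷ mapᴬ (λ {C} ¬ap → ¬ap ∘ HasAP-≤ (∁ C) (m≤n⊔m k l)) ¬l

    missing : ∀ (L : List (Pred X 0ℓ)) x → ¬ x ∈ ⋂ L → ∃[ j ] ¬ x ∈ lookup L j
    missing [] x ∉ = ⊥-elim (∉ tt)
    missing (B ∷ L) x ∉ with em {P = x ∈ B}
    ... | no x∉B = zero , x∉B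
    ... | yes x∈B = let j , h = missing L x (∉ ∘ (x∈B ,_)) in suc j , h

    -- If the intersection were empty, colouring each number by a set that omits it would put a long
    -- progression into one of the complements.
    coRich-fip : ∀ L → All (λ B → ¬ APRich (∁ B)) L → Satisfiable (⋂ L)
    coRich-fip L all with commonBound L all
    ... | k , short = dne λ empty →
      let colour = λ x → missing L x (λ x∈ → empty (x , x∈))
          N , mono = vanDerWaerden k (length L)
          a , d , d≢0 , _ , c , same = mono (proj₁ ∘ colour)
      in lookupᴬ short (∈-lookup c) (a , d , d≢0 , λ i i<k →
           subst (λ j → ¬ (a + i * d) ∈ lookup L j) (same i (m<n⇒m<1+n i<k)) (proj₂ (colour (a + i * d))))

    ∃-rich : ∃[ 𝓅 ] Rich 𝓅
    ∃-rich = let 𝓅 , ⊆𝓅 = ultrafilter-⊇ (λ B → ¬ APRich (∁ B)) coRich-fip in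
      𝓅 , λ A A∈𝓅 → dne λ ¬rich → proper 𝓅 (upward 𝓅 (λ (a , ¬a) → ¬a a)
        (inter 𝓅 A∈𝓅 (⊆𝓅 {∁ A} λ rich → ¬rich λ k →
          let b , d , d≢0 , h = rich k in b , d , d≢0 , λ i i<k → dne {P = A (b + i * d)} (h i i<k))))

    -- Places rich ultrafilters in the multiplicative semigroup. Length two is enough: the second
    -- term `b + d` is positive.
    rich⇒≢0 : ∀ 𝒰 → Rich 𝒰 → 𝒰 ∈ ⟦ _≢ 0 ⟧
    rich⇒≢0 𝒰 rich = dne λ ∉ →
      let b , d , d≢0 , h = rich (∁ (_≢ 0)) (∉⇒∁∈ 𝒰 ∉) 2
      in d≢0 (m+n≡0⇒m≡0 d (m+n≡0⇒n≡0 b (dne {P = b + 1 * d ≡ 0} (h 1 (s≤s (s≤s z≤n))))))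

    -- Minimal ideals are rich

    K⊕-rich : K⊕ ⊆ Rich
    K⊕-rich (I , minimal , 𝒰∈I) = minimalIdeal-rich
      (let 𝓅 , rich = ∃-rich in 𝓅 , tt , rich)
      (λ {𝒰} {𝒱} _ → extend-richʳ _+_ 𝒰 𝒱 (upward 𝒰 (λ _ → translation-affine _) (whole 𝒰)))
      (λ {𝒰} {𝒱} rich _ → extend-richˡ _+_ 𝒰 𝒱 rich (upward 𝒱 (λ _ → translation-affineʳ _) (whole 𝒱)))
      minimal 𝒰∈I

    K⊙-rich : K⊙ ⊆ Rich
    K⊙-rich (I , minimal , 𝒰∈I) = minimalIdeal-rich
      (let 𝓅 , rich = ∃-rich in 𝓅 , rich⇒≢0 𝓅 rich , rich)
      (λ {𝒰} {𝒱} ≢0 → extend-richʳ _*_ 𝒰 𝒱 (upward 𝒰 dilation-affine ≢0))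
      (λ {𝒰} {𝒱} rich ≢0 → extend-richˡ _*_ 𝒰 𝒱 rich (upward 𝒱 dilation-affineʳ ≢0))
      minimal 𝒰∈I

    closure-rich : (S : Pred (β ℕ) ℓ) → S ⊆ Rich → closure S ⊆ Rich
    closure-rich S S⊆rich 𝒰∈ A A∈𝒰 = let 𝒱 , 𝒱∈S , A∈𝒱 = 𝒰∈ A A∈𝒰 in S⊆rich {𝒱} 𝒱∈S A A∈𝒱

    -- Existence of a minimal additive ideal

    Thick : Pred (Pred ℕ 0ℓ) 0ℓ
    Thick A = ∀ n → ∃[ x ] (∀ s → s < n → (s + x) ∈ A)

    thickFilter : MaximalFilter Thick
    thickFilter = proj₁ (maximalFilter Thick
      (λ A⊆B thick n → let x , h = thick n in x , λ s s<n → A⊆B (h s s<n))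
      (λ _ → ⊥) λ { [] [] n → 0 , λ _ _ → tt })

    open MaximalFilter thickFilter

    -- An interval of length `t + n` in `A ∩ B` leaves `n` places where both `B` and the translate
    -- of `A` hold; maximality then applies.
    member-translate : ∀ {A} t → A ∈ member → (λ r → (t + r) ∈ A) ∈ member
    member-translate {A} t A∈ = maximal _ λ B B∈ n →
      let x , h = large (∩-member A∈ B∈) (t + n) in
      x , λ s s<n → subst A (+-assoc t s x) (proj₁ (h (t + s) (+-monoʳ-< t s<n)))
                  , proj₂ (h s (<-≤-trans s<n (m≤n+m n t)))

    L⊕ : Pred (β ℕ) _
    L⊕ 𝓍 = member ⊆ sets 𝓍

    L⊕-left : ∀ 𝒰 𝓍 → 𝓍 ∈ L⊕ → (𝒰 ⊕ 𝓍) ∈ L⊕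
    L⊕-left 𝒰 𝓍 𝓍∈L A∈ = upward 𝒰 (λ {s} _ → 𝓍∈L (member-translate s A∈)) (whole 𝒰)

    -- A point common to the first `n` translates of `A` and of `B` starts an interval in `A ∩ B`,
    -- which is therefore thick.
    always-return : ∀ 𝓍 {A} → 𝓍 ∈ L⊕ → (∀ s → (λ r → (s + r) ∈ A) ∈ sets 𝓍) → A ∈ member
    always-return 𝓍 {A} 𝓍∈L h = maximal A λ B B∈ n → nonempty-member 𝓍
      (upward 𝓍 (λ (f , g) s s<n → f s s<n , g s s<n)
        (inter 𝓍 (bounded-inter 𝓍 (λ s r → (s + r) ∈ A) n λ s _ → h s)
                 (bounded-inter 𝓍 (λ s r → (s + r) ∈ B) n λ s _ → 𝓍∈L (member-translate s B∈))))

    -- For `A` in `𝓎` the return set to `A` is inhabited, since otherwise `always-return` puts `∁ A`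
    -- into `𝓎`. Any `𝒱` containing all these return sets works.
    L⊕-minimal : ∀ 𝓍 𝓎 → 𝓍 ∈ L⊕ → 𝓎 ∈ L⊕ → ∃[ 𝒱 ] (𝒱 ⊕ 𝓍) ≈ 𝓎
    L⊕-minimal 𝓍 𝓎 𝓍∈L 𝓎∈L =
      let 𝒱 , ⊆𝒱 = ultrafilter-⊇ Returns fip
          𝓎≈ = ⊆⇒≈ {𝒰 = 𝓎} {𝒱 ⊕ 𝓍} λ {A} A∈𝓎 → ⊆𝒱 (A , A∈𝓎 , id)
      in 𝒱 , proj₂ 𝓎≈ , proj₁ 𝓎≈
      where
      returns : Pred ℕ 0ℓ → Pred ℕ 0ℓ
      returns A s = (λ r → (s + r) ∈ A) ∈ sets 𝓍
      Returns : Pred (Pred ℕ 0ℓ) _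
      Returns C = ∃[ A ] A ∈ sets 𝓎 × returns A ⊆ C
      ⋂-returns : ∀ L → All Returns L → Returns (⋂ L)
      ⋂-returns [] [] = U , whole 𝓎 , λ _ → tt
      ⋂-returns (C ∷ L) ((A , A∈ , A⊆) ∷ all) = let B , B∈ , B⊆ = ⋂-returns L all in
        A ∩ B , inter 𝓎 A∈ B∈ , λ h → A⊆ (upward 𝓍 proj₁ h) , B⊆ (upward 𝓍 proj₂ h)
      fip : ∀ L → All Returns L → Satisfiable (⋂ L)
      fip L all = let A , A∈ , A⊆ = ⋂-returns L all in
        dne λ empty → proper 𝓎 (upward 𝓎 (λ (a , ¬a) → ¬a a) (inter 𝓎 A∈
          (𝓎∈L (always-return 𝓍 {∁ A} 𝓍∈L λ s → ∉⇒∁∈ 𝓍 {λ r → (s + r) ∈ A} (λ h → empty (s , A⊆ h))))))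

    -- The minimal left ideal multiplied on the right by the whole semigroup.
    I⊕ : Pred (β ℕ) _
    I⊕ 𝒲 = ∃[ 𝓍 ] 𝓍 ∈ L⊕ × ∃[ 𝒰 ] (𝓍 ⊕ 𝒰) ≈ 𝒲

    ⊕-assoc : ∀ 𝒰 𝒱 𝒲 → ((𝒰 ⊕ 𝒱) ⊕ 𝒲) ≈ (𝒰 ⊕ (𝒱 ⊕ 𝒲))
    ⊕-assoc 𝒰 𝒱 𝒲 =
      (λ {A} → upward 𝒰 (λ {s} → upward 𝒱 λ {t} → upward 𝒲 λ {r} → subst A (+-assoc s t r))) ,
      (λ {A} → upward 𝒰 (λ {s} → upward 𝒱 λ {t} → upward 𝒲 λ {r} → subst A (sym (+-assoc s t r))))

    I⊕-ideal : IsIdeal U _⊕_ I⊕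
    I⊕-ideal = record
      { within   = λ _ → tt
      ; respects = λ 𝒱≈𝒲 (𝓍 , 𝓍∈L , 𝒰 , p , q) →
          𝓍 , 𝓍∈L , 𝒰 , (λ {A} A∈ → proj₁ 𝒱≈𝒲 (p {A} A∈)) , λ {A} A∈ → q {A} (proj₂ 𝒱≈𝒲 A∈)
      ; nonempty = let 𝓍 , 𝓍∈L = L⊕-nonempty in 𝓍 ⊕ 𝓍 , 𝓍 , 𝓍∈L , 𝓍 , id , id
      ; left     = λ {𝒱} {𝒲} _ (𝓍 , 𝓍∈L , 𝒰 , p , q) →
          𝒱 ⊕ 𝓍 , L⊕-left 𝒱 𝓍 𝓍∈L , 𝒰 ,
          (λ {A} A∈ → upward 𝒱 (λ {s} → p {λ r → (s + r) ∈ A}) (proj₁ (⊕-assoc 𝒱 𝓍 𝒰) {A} A∈)) ,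
          (λ {A} A∈ → proj₂ (⊕-assoc 𝒱 𝓍 𝒰) {A} (upward 𝒱 (λ {s} → q {λ r → (s + r) ∈ A}) A∈))
      ; right    = λ {𝒲} {𝒱} (𝓍 , 𝓍∈L , 𝒰 , p , q) _ →
          𝓍 , 𝓍∈L , 𝒰 ⊕ 𝒱 ,
          (λ {A} A∈ → p {λ n → (λ r → (n + r) ∈ A) ∈ sets 𝒱} (proj₂ (⊕-assoc 𝓍 𝒰 𝒱) {A} A∈)) ,
          (λ {A} A∈ → proj₁ (⊕-assoc 𝓍 𝒰 𝒱) {A} (q {λ n → (λ r → (n + r) ∈ A) ∈ sets 𝒱} A∈))
      }
      where
      member-fip : ∀ L → All member L → ⋂ L ∈ member
      member-fip [] [] = maximal U λ B B∈ n → let x , h = large B∈ n in x , λ s s<n → tt , h s s<n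
      member-fip (A ∷ L) (A∈ ∷ all) = ∩-member A∈ (member-fip L all)
      L⊕-nonempty : Satisfiable L⊕
      L⊕-nonempty = ultrafilter-⊇ member λ L all →
        let x , h = large (member-fip L all) 1 in 0 + x , h 0 (s≤s z≤n)

    I⊕-minimal : IsMinimalIdeal U _⊕_ I⊕
    I⊕-minimal = I⊕-ideal , λ J J-ideal _ {𝒲} (𝓎 , 𝓎∈L , 𝒰 , 𝓎𝒰≈𝒲) →
      let module J = IsIdeal J-ideal
          𝒿 , 𝒿∈J = J.nonempty
          -- `𝒿 ⊕ 𝓎` lies in both `J` and `L⊕`, and minimality of the left ideal recovers `𝓎` from
          -- it.
          𝒱 , 𝒱𝒿𝓎≈𝓎 = L⊕-minimal (𝒿 ⊕ 𝓎) 𝓎 (L⊕-left 𝒿 𝓎 𝓎∈L) 𝓎∈L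
          𝓎∈J = J.respects {𝒱 ⊕ (𝒿 ⊕ 𝓎)} {𝓎} 𝒱𝒿𝓎≈𝓎 (J.left {𝒱} {𝒿 ⊕ 𝓎} tt (J.right {𝒿} {𝓎} 𝒿∈J tt))
      in J.respects {𝓎 ⊕ 𝒰} {𝒲} 𝓎𝒰≈𝒲 (J.right {𝓎} {𝒰} 𝓎∈J tt)

    K⊕-nonempty : Satisfiable K⊕
    K⊕-nonempty = let 𝒰 , 𝒰∈I = IsIdeal.nonempty I⊕-ideal in 𝒰 , I⊕ , I⊕-minimal , 𝒰∈I

    -- Maximality and closure of the images under Ḡ

    Ḡ-rich : ∀ {𝒰 𝒱} → Rich 𝒰 → 𝒱 ∈ Θ_R → Rich (Ḡ 𝒰 𝒱)
    Ḡ-rich {𝒰} {𝒱} rich 𝒱∈Θ = extend-richˡ G 𝒰 𝒱 rich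
      (upward 𝒱 (λ {p} r → proj₁ p , proj₂ p , R⇒≢0 r , λ _ → refl) 𝒱∈Θ)

    Ḡ-cover : ∀ A → APRich A → ∀ 𝒰 → ∃[ 𝒱 ] 𝒱 ∈ Θ_R × A ∈ sets (Ḡ 𝒰 𝒱)
    Ḡ-cover A rich 𝒰 =
      let 𝒱 , ⊆𝒱 = ultrafilter-⊇ Preimage fip in
      -- `R` contains each of the preimage sets; the index 0 is arbitrary.
      𝒱 , ⊆𝒱 (0 , proj₁) , upward 𝒰 (λ {n} _ → ⊆𝒱 (n , proj₂)) (whole 𝒰)
      where
      Preimage : Pred (Pred (ℕ × ℕ) 0ℓ) _
      Preimage B = ∃[ n ] (λ p → p ∈ R × G n p ∈ A) ⊆ B
      bound : ∀ L → All Preimage L → ∃[ k ] (∀ {p} → p ∈ R → (∀ n → n < k → G n p ∈ A) → p ∈ ⋂ L)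
      bound [] [] = 0 , λ _ _ → tt
      bound (B ∷ L) ((n , ⊆B) ∷ all) = let k , h = bound L all in
        suc n ⊔ k , λ r g →
          ⊆B (r , g n (m≤m⊔n (suc n) k)) ,
          h r (λ i i<k → g i (<-≤-trans i<k (m≤n⊔m (suc n) k)))
      fip : ∀ L → All Preimage L → Satisfiable (⋂ L)
      fip L all = let k , h = bound L all
                      b , d , d≢0 , ap = rich k in
        (d , b) , h (≢0⇒R d≢0) λ n n<k →
          subst A (G-term b d n) (ap n n<k)

    -- Forward, comparison with one rich ultrafilter suffices. Backward, `U` serves as the smaller
    -- set: a long progression in `B` is the affine image of an initial segment containing `F`.
    maximal⇔rich : M 𝒜 ≐ Rich
    maximal⇔rich =
      (λ {𝒰} max B B∈𝒰 k →
        let 𝓅 , rich = ∃-rich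
            A , A∈𝓅 , A≤B = max 𝓅 B B∈𝒰
            b , d , d≢0 , h = rich A A∈𝓅 k
            f , f∈𝒜 , all = A≤B (applyUpTo (λ i → b + i * d) k) (applyUpTo⁺₁ _ k (h _))
        in HasAP-preimage B f∈𝒜 (b , d , d≢0 , λ i → applyUpTo⁻ _ k all)) ,
      (λ rich 𝒱 B B∈𝒰 → U , whole 𝒱 , λ F _ →
        let k , h = bound F
            b , d , d≢0 , ap = rich B B∈𝒰 k
        in (λ n → d * n + b) , (d , b , d≢0 , λ _ → refl) ,
           mapᴬ (λ {n} n<k → subst B (G-term b d n) (ap n n<k)) h)
      where
      bound : ∀ F → ∃[ k ] All (_< k) F
      bound [] = 0 , []
      bound (n ∷ F) = let k , h = bound F in
        suc n ⊔ k , m≤m⊔n (suc n) k ∷ mapᴬ (λ i<k → <-≤-trans i<k (m≤n⊔m (suc n) k)) h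

    maximal≐closure : ∀ 𝒰 → Rich 𝒰 → M 𝒜 ≐ closure (Ḡ-image 𝒰)
    maximal≐closure 𝒰 𝒰-rich =
      (λ {𝒲} max A A∈ → let 𝒱 , 𝒱∈Θ , A∈Ḡ = Ḡ-cover A (proj₁ maximal⇔rich {𝒲} max A A∈) 𝒰 in
        Ḡ 𝒰 𝒱 , (𝒱 , 𝒱∈Θ , id , id) , A∈Ḡ) ,
      (λ {𝒲} 𝒲∈ → proj₂ maximal⇔rich {𝒲} (closure-rich (Ḡ-image 𝒰)
        (λ (𝒱 , 𝒱∈Θ , 𝒲≈) A A∈ → Ḡ-rich {𝒰} {𝒱} 𝒰-rich 𝒱∈Θ A (proj₁ 𝒲≈ A∈)) {𝒲} 𝒲∈))

    APRich⇔ : ∀ A → APRich A ⇔ (∀ 𝒰 → 𝒰 ∈ closure K⊕ → ∃[ 𝒱 ] 𝒱 ∈ Θ_R × A ∈ sets (Ḡ 𝒰 𝒱))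
    APRich⇔ A = mk⇔ (λ rich 𝒰 _ → Ḡ-cover A rich 𝒰) backward
      where
      backward : (∀ 𝒰 → 𝒰 ∈ closure K⊕ → ∃[ 𝒱 ] 𝒱 ∈ Θ_R × A ∈ sets (Ḡ 𝒰 𝒱)) → APRich A
      backward h =
        -- Without a point in the minimal ideal the hypothesis `h` would be vacuous.
        let 𝒰 , 𝒰∈K = K⊕-nonempty
            𝒱 , 𝒱∈Θ , A∈ = h 𝒰 (λ B B∈ → 𝒰 , 𝒰∈K , B∈)
        in Ḡ-rich {𝒰} {𝒱} (K⊕-rich {𝒰} 𝒰∈K) 𝒱∈Θ A A∈

mainTheorem7 : (∀ {ℓ} → ExcludedMiddle ℓ) →
    (∀ {a b} → Extensionality a b) →
    (M 𝒜 ≐ (λ 𝒰 → ∀ A → A ∈ sets 𝒰 → APRich A))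
    × (∀ 𝒰 → 𝒰 ∈ closure K⊕ ∪ closure K⊙ →
    M 𝒜 ≐ closure (Ḡ-image 𝒰))
    × (∀ (A : Pred ℕ 0ℓ) →
    APRich A ⇔
    (∀ 𝒰 → 𝒰 ∈ closure K⊕ →
    ∃[ 𝒱 ] 𝒱 ∈ Θ_R × A ∈ sets (Ḡ 𝒰 𝒱)))
mainTheorem7 em ext =
  maximal⇔rich em ext ,
  (λ 𝒰 𝒰∈ → maximal≐closure em ext 𝒰
    ([ closure-rich em ext K⊕ (K⊕-rich em ext) {𝒰} , closure-rich em ext K⊙ (K⊙-rich em ext) {𝒰} ]′ 𝒰∈)) ,
  APRich⇔ em ext
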